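{- Let $n$ be a positive integer and let the edges of the complete graph $K_n$ be properly coloured using $n-1$ colours. Then this coloured $K_n$ contains at least $n/9-6$ pairwise edge-disjoint spanning rainbow trees.
   Context: An edge-colouring is proper if no two edges sharing a vertex have the same colour. A subgraph is rainbow if all its edges have different colours. A subgraph is spanning if it contains all vertices of the host graph. -}

module Defs where

open import Data.Bool.Base using (Bool; T)
open import Data.Fin.Base using (Fin; _<_)
open import Data.Fin.Subset using (Subset; Nonempty; _∈_)
open import Data.List.Base using (List; _∷_; _∷ʳ_; length)
open import Data.List.Relation.Unary.Linked using (Linked)
open import Data.List.Relation.Unary.Unique.Propositional using (Unique)
open import Data.Nat.Base using (ℕ; _≤_)
open import Data.Product.Base using (_×_; ∃-syntax)
open import Data.Sum.Base using (_⊎_)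
open import Relation.Binary.Construct.Closure.ReflexiveTransitive using (Star)
open import Relation.Binary.PropositionalEquality.Core using (_≡_; _≢_)
open import Relation.Nullary.Negation.Core using (¬_)

private
  variable
    n : ℕ

-- An edge of Kₙ is an unordered pair of distinct vertices, represented by
-- its increasing ordering.  The ordering proof is irrelevant, so two edges
-- are equal exactly when they have the same endpoints.
record Edge (n : ℕ) : Set where
  constructor edge
  field
    lo hi  : Fin n
    .lo<hi : lo < hi

open Edge public

_∈ᵉ_ : Fin n → Edge n → Set
v ∈ᵉ e = (v ≡ lo e) ⊎ (v ≡ hi e)

Joins : Edge n → Fin n → Fin n → Set
Joins e u v = (u ≡ lo e × v ≡ hi e) ⊎ (u ≡ hi e × v ≡ lo e)

ShareVertex : Edge n → Edge n → Set
ShareVertex e f = ∃[ v ] (v ∈ᵉ e × v ∈ᵉ f)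

EdgeColouring : ℕ → Set → Set
EdgeColouring n C = Edge n → C

Proper : {C : Set} → EdgeColouring n C → Set
Proper {n} c = (e f : Edge n) → e ≢ f → ShareVertex e f → c e ≢ c f

record Subgraph (n : ℕ) : Set where
  field
    vertices  : Subset n
    edges     : Edge n → Bool
    endpoints : ∀ e v → T (edges e) → v ∈ᵉ e → v ∈ vertices

open Subgraph public

_∈ᴱ_ : Edge n → Subgraph n → Set
e ∈ᴱ G = T (edges G e)

Adjacent : Subgraph n → Fin n → Fin n → Set
Adjacent G u v = ∃[ e ] (e ∈ᴱ G × Joins e u v)

record Connected (G : Subgraph n) : Set where
  field
    nonempty : Nonempty (vertices G)
    walk     : ∀ u v → u ∈ vertices G → v ∈ vertices G → Star (Adjacent G) u v

-- A cycle start, rest₁, …, restₖ, start with k + 1 ≥ 3 distinct vertices.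
record Cycle (G : Subgraph n) : Set where
  field
    start    : Fin n
    rest     : List (Fin n)
    long     : 2 ≤ length rest
    distinct : Unique (start ∷ rest)
    closed   : Linked (Adjacent G) (start ∷ (rest ∷ʳ start))

record IsTree (G : Subgraph n) : Set where
  field
    connected : Connected G
    acyclic   : ¬ Cycle G

Spanning : Subgraph n → Set
Spanning {n} G = (v : Fin n) → v ∈ vertices G

Rainbow : {C : Set} → EdgeColouring n C → Subgraph n → Set
Rainbow c G = ∀ e f → e ∈ᴱ G → f ∈ᴱ G → e ≢ f → c e ≢ c f

record IsSpanningRainbowTree {C : Set} (c : EdgeColouring n C) (G : Subgraph n) : Set where
  field
    isTree   : IsTree G
    spanning : Spanning G
    rainbow  : Rainbow c G

EdgeDisjoint : Subgraph n → Subgraph n → Set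
EdgeDisjoint G H = ∀ e → ¬ (e ∈ᴱ G × e ∈ᴱ H)

{-# OPTIONS --safe #-}

-- Adding a diagonal colour turns the colouring into a symmetric Latin square, and a rooted
-- rainbow spanning tree into a permutation π from vertices to colours: the edge from u to its
-- parent has colour π u.  Exchanging two values of π keeps the tree rainbow.
-- Start with the spanning stars at 2h vertices v i, which share only the edges v i v j.  A
-- balanced tournament decides that the loser j gives up v i v j, of colour a.  In tree j the
-- values of v i and of some x are exchanged, so that v i hangs from a vertex y in a colour b and
-- x is joined to z in colour a.  If v i y belongs to tree i, there the values of y and of some
-- y′ are exchanged.  Every tree moves at most 3h vertices that are not roots.  The choice of x
-- excludes at most 18h vertices: the 4h worst y, which by double counting leaves every other y
-- in conflict with at most 6h vertices y′, and 14h for the other requirements.  The choice of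
-- y′ then excludes at most 18h + 1.  So n ≥ 18h + 2 suffices.

module Submission where

open import Data.Empty using (⊥; ⊥-elim-irr)
open import Data.Fin.Base as Fin using (Fin; zero; suc; quotient; remainder; combine; punchOut; inject≤)
open import Data.Fin.Permutation using (Permutation′; _⟨$⟩ʳ_; _⟨$⟩ˡ_; permutation; inverseˡ; inverseʳ; _∘ₚ_; transpose)
open import Data.Fin.Properties as Finₚ using (_≟_; _<?_; <-cmp; any?; ¬∀⟶∃¬; injective⇒≤; punchOut-injective; inject≤-injective; combine-remQuot)
open import Data.Fin.Subset using () renaming (⊤ to full)
open import Data.Fin.Subset.Properties using (∈⊤)
open import Data.Integer.Base as ℤ using (+_)
import Data.Integer.Properties as ℤₚ
import Data.Integer.Tactic.RingSolver as ℤ-Solver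
open import Data.List.Base using (List; []; _∷_; _++_; _∷ʳ_; length; lookup; map; filter; concatMap; allFin; cartesianProduct)
open import Data.List.Membership.DecPropositional using (_∈?_)
open import Data.List.Membership.Propositional using (_∈_; _∉_)
open import Data.List.Membership.Propositional.Properties using (∈-filter⁺; ∈-filter⁻; ∈-map⁺; ∈-allFin; ∈-lookup; ∈-concat⁺′; ∈-cartesianProduct⁺; ∈-++⁺ˡ; ∈-++⁺ʳ)
open import Data.List.Properties using (length-++; length-map; length-tabulate; filter-accept; filter-reject)
open import Data.List.Relation.Unary.All as All using (All; []; _∷_)
open import Data.List.Relation.Unary.All.Properties using (all-filter)
open import Data.List.Relation.Unary.AllPairs using ([]; _∷_)
open import Data.List.Relation.Unary.Any using (here; there; index)
open import Data.List.Relation.Unary.Any.Properties using (lookup-index)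
open import Data.List.Relation.Unary.Linked using (Linked; _∷_)
open import Data.List.Relation.Unary.Unique.Propositional using (Unique)
open import Data.List.Relation.Unary.Unique.Propositional.Properties using (allFin⁺; filter⁺; cartesianProduct⁺)
open import Data.Nat.Base using (ℕ; zero; suc; NonZero; _+_; _*_; _∸_; _≤_; _<_; z≤n; s≤s)
open import Data.Nat.DivMod using (m/n*n≤m; m≡m%n+[m/n]*n; m%n<n) renaming (_/_ to _/ℕ_)
open import Data.Nat.ListAction using (sum)
open import Data.Nat.Properties as ℕₚ using (_≤?_; ≤-refl; ≤-reflexive; ≤-trans; +-mono-≤; *-cancelʳ-≤; ≰⇒>; ≤-pred; <⇒≱)
open import Data.Nat.Tactic.RingSolver using (solve-∀)
open import Data.Product.Base using (_×_; _,_; Σ-syntax; ∃-syntax; proj₁; proj₂; uncurry)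
open import Data.Product.Properties using (≡-dec)
open import Data.Rational.Base using (_/_; _-_; _≥_; toℚᵘ; -_)
import Data.Rational.Properties as ℚₚ
open import Data.Rational.Unnormalised.Base as ℚᵘ using (mkℚᵘ; *≤*)
import Data.Rational.Unnormalised.Properties as ℚᵘₚ
open import Data.Sum.Base as Sum using (_⊎_; inj₁; inj₂)
open import Data.Unit.Base using (⊤; tt)
open import Function.Base using (_∘_)
open import Relation.Binary.Construct.Closure.ReflexiveTransitive using (Star; ε; _◅_; _◅◅_; reverse)
open import Relation.Binary.Definitions using (tri<; tri≈; tri>)
open import Relation.Binary.PropositionalEquality using (_≡_; _≢_; refl; sym; trans; cong; cong₂; subst)
open import Relation.Nullary using (¬_; Dec; yes; no; contradiction; ¬?; _×-dec_; _⊎-dec_)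
open import Relation.Nullary.Decidable using (⌊_⌋; toWitness; fromWitness; decidable-stable)
open import Defs

private
  variable
    A B : Set
    n : ℕ

-- Avoidance and double counting in lists

-- Otherwise the position of each element in `xs` would inject `Fin n` into a smaller set.
avoid : (xs : List (Fin n)) → length xs < n → ∃[ x ] x ∉ xs
avoid {n} xs short = ¬∀⟶∃¬ n (_∈ xs) (λ x → _∈?_ _≟_ x xs) λ all →
  <⇒≱ short (injective⇒≤ {f = λ x → index (all x)} λ {x} {y} eq →
    trans (lookup-index (all x)) (trans (cong (lookup xs) eq) (sym (lookup-index (all y)))))

lookup-injective : ∀ {xs : List A} → Unique xs → ∀ k l → lookup xs k ≡ lookup xs l → k ≡ l
lookup-injective (_ ∷ _)      zero    zero    _  = refl
lookup-injective (x∉xs ∷ _)   zero    (suc l) eq = contradiction eq (All.lookup x∉xs (∈-lookup l))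
lookup-injective (x∉xs ∷ _)   (suc k) zero    eq = contradiction (sym eq) (All.lookup x∉xs (∈-lookup k))
lookup-injective (_ ∷ unique) (suc k) (suc l) eq = cong suc (lookup-injective unique k l eq)

length-injective-≤ : ∀ {h} (f : A → Fin h) {xs : List A} → Unique xs →
  (∀ {x y} → x ∈ xs → y ∈ xs → f x ≡ f y → x ≡ y) → length xs ≤ h
length-injective-≤ f {xs} unique inj = injective⇒≤ {f = λ k → f (lookup xs k)} λ {k} {l} eq →
  lookup-injective unique k l (inj (∈-lookup k) (∈-lookup l) eq)

length-concatMap-≤ : ∀ (f : A → List B) c xs → (∀ x → length (f x) ≤ c) →
  length (concatMap f xs) ≤ length xs * c
length-concatMap-≤ f c []       bound = z≤n
length-concatMap-≤ f c (x ∷ xs) bound = ≤-trans (≤-reflexive (length-++ (f x)))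
  (+-mono-≤ (bound x) (length-concatMap-≤ f c xs bound))

length-++-≤ : ∀ {A : Set} (xs : List A) {ys a b} → length xs ≤ a → length ys ≤ b → length (xs ++ ys) ≤ a + b
length-++-≤ xs xs≤ ys≤ = ≤-trans (≤-reflexive (length-++ xs)) (+-mono-≤ xs≤ ys≤)

length-map-≤ : ∀ {A B : Set} (f : A → B) xs {a} → length xs ≤ a → length (map f xs) ≤ a
length-map-≤ f xs = ≤-trans (≤-reflexive (length-map f xs))

∈-concatMap : ∀ {f : A → List B} {x y xs} → x ∈ xs → y ∈ f x → y ∈ concatMap f xs
∈-concatMap {f = f} x∈xs y∈fx = ∈-concat⁺′ y∈fx (∈-map⁺ f x∈xs)

fibre : Fin n → List (Fin n × B) → List (Fin n × B)
fibre y = filter (λ r → proj₁ r ≟ y)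

sum-fibres-∉ : ∀ (r : Fin n × B) R {H} → All (proj₁ r ≢_) H →
  sum (map (λ y → length (fibre y (r ∷ R))) H) ≡ sum (map (λ y → length (fibre y R)) H)
sum-fibres-∉ r R []                  = refl
sum-fibres-∉ r R (_∷_ {x = y} r≢y r∉H) = cong₂ _+_
  (cong length (filter-reject (λ r → proj₁ r ≟ y) r≢y)) (sum-fibres-∉ r R r∉H)

-- As `H` has no repetitions, `r` lies in the fibre of at most one member of `H`.
sum-fibres-∷ : ∀ (r : Fin n × B) R {H} → Unique H →
  sum (map (λ y → length (fibre y (r ∷ R))) H) ≤ suc (sum (map (λ y → length (fibre y R)) H))
sum-fibres-∷ r R []                  = z≤n
sum-fibres-∷ r R (_∷_ {x = y} y∉H unique) with proj₁ r ≟ y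
... | yes refl = s≤s (≤-reflexive (cong₂ _+_ {x = length (fibre y R)} refl (sum-fibres-∉ r R y∉H)))
... | no  r≢y  = ≤-trans (ℕₚ.+-monoʳ-≤ (length (fibre y R)) (sum-fibres-∷ r R unique))
  (≤-reflexive (ℕₚ.+-suc (length (fibre y R)) _))

sum-fibres-≤ : ∀ (R : List (Fin n × B)) {H} → Unique H →
  sum (map (λ y → length (fibre y R)) H) ≤ length R
sum-fibres-≤ []      {H} unique = ≤-reflexive (zeros H)
  where
  zeros : ∀ H → sum (map (λ _ → 0) H) ≡ 0
  zeros []      = refl
  zeros (_ ∷ H) = zeros H
sum-fibres-≤ (r ∷ R) unique =
  ≤-trans (sum-fibres-∷ r R unique) (s≤s (sum-fibres-≤ R unique))

length*≤sum : ∀ (f : A → ℕ) c {xs} → All (λ x → c ≤ f x) xs → length xs * c ≤ sum (map f xs)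
length*≤sum f c []             = z≤n
length*≤sum f c (c≤fx ∷ c≤fxs) = +-mono-≤ c≤fx (length*≤sum f c c≤fxs)

-- Double counting: the fibres over the members of `H` are disjoint parts of `R`, and each has at
-- least `suc f` entries.
few-large-fibres : ∀ f m (R : List (Fin n × B)) → length R ≤ m * suc f →
  ∃[ H ] length H ≤ m × (∀ y → y ∉ H → length (fibre y R) ≤ f)
few-large-fibres {n} f m R bound = H , *-cancelʳ-≤ _ _ (suc f) count , small
  where
  large? = λ y → suc f ≤? length (fibre y R)
  H = filter large? (allFin n)
  count : length H * suc f ≤ m * suc f
  count = ≤-trans
    (length*≤sum (λ y → length (fibre y R)) (suc f) (All.tabulate (λ {y} y∈H → proj₂ (∈-filter⁻ large? {xs = allFin n} y∈H))))
    (≤-trans (sum-fibres-≤ R (filter⁺ large? (allFin⁺ n))) bound)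
  small : ∀ y → y ∉ H → length (fibre y R) ≤ f
  small y y∉H with large? y
  ... | yes large = contradiction (∈-filter⁺ large? (∈-allFin y) large) y∉H
  ... | no ¬large = ≤-pred (≰⇒> ¬large)

-- A balanced tournament on 2h players

Fin2-≢-unique : ∀ {a b c : Fin 2} → a ≢ b → a ≢ c → b ≡ c
Fin2-≢-unique {zero}     {zero}     a≢b _   = contradiction refl a≢b
Fin2-≢-unique {zero}     {suc zero} {zero}     _ a≢c = contradiction refl a≢c
Fin2-≢-unique {zero}     {suc zero} {suc zero} _ _   = refl
Fin2-≢-unique {suc zero} {zero}     {zero}     _ _   = refl
Fin2-≢-unique {suc zero} {zero}     {suc zero} _ a≢c = contradiction refl a≢c
Fin2-≢-unique {suc zero} {suc zero} a≢b _   = contradiction refl a≢b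

module Tournament (h : ℕ) where

  private
    q : Fin (h * 2) → Fin h
    q = quotient 2
    r : Fin (h * 2) → Fin 2
    r = remainder {h} 2

    qr-injective : ∀ {i j} → q i ≡ q j → r i ≡ r j → i ≡ j
    qr-injective {i} {j} q≡ r≡ = trans (sym (combine-remQuot {h} 2 i))
      (trans (cong₂ combine q≡ r≡) (combine-remQuot {h} 2 j))

  -- The 2h players form h pairs; every player beats at most one player of each pair
  -- and loses to at most one player of each pair.
  Beats : Fin (h * 2) → Fin (h * 2) → Set
  Beats i j = (q i Fin.< q j × r i ≡ r j) ⊎ (q j Fin.< q i × r i ≢ r j) ⊎ (q i ≡ q j × r i Fin.< r j)

  beats? : ∀ i j → Dec (Beats i j)
  beats? i j = (q i <? q j ×-dec r i ≟ r j) ⊎-dec (q j <? q i ×-dec ¬? (r i ≟ r j))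
    ⊎-dec (q i ≟ q j ×-dec r i <? r j)

  beats-irrefl : ∀ i → ¬ Beats i i
  beats-irrefl i (inj₁ (i<i , _))        = Finₚ.<-irrefl refl i<i
  beats-irrefl i (inj₂ (inj₁ (i<i , _))) = Finₚ.<-irrefl refl i<i
  beats-irrefl i (inj₂ (inj₂ (_ , i<i))) = Finₚ.<-irrefl refl i<i

  beats-total : ∀ i j → i ≢ j → Beats i j ⊎ Beats j i
  beats-total i j i≢j with <-cmp (q i) (q j) | <-cmp (r i) (r j)
  ... | tri< q< _ _ | tri≈ _ r≡ _ = inj₁ (inj₁ (q< , r≡))
  ... | tri< q< _ _ | tri< _ r≢ _ = inj₂ (inj₂ (inj₁ (q< , r≢ ∘ sym)))
  ... | tri< q< _ _ | tri> _ r≢ _ = inj₂ (inj₂ (inj₁ (q< , r≢ ∘ sym)))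
  ... | tri≈ _ q≡ _ | tri< r< _ _ = inj₁ (inj₂ (inj₂ (q≡ , r<)))
  ... | tri≈ _ q≡ _ | tri≈ _ r≡ _ = contradiction (qr-injective q≡ r≡) i≢j
  ... | tri≈ _ q≡ _ | tri> _ _ r> = inj₂ (inj₂ (inj₂ (sym q≡ , r>)))
  ... | tri> _ _ q> | tri≈ _ r≡ _ = inj₂ (inj₁ (q> , sym r≡))
  ... | tri> _ _ q> | tri< _ r≢ _ = inj₁ (inj₂ (inj₁ (q> , r≢)))
  ... | tri> _ _ q> | tri> _ r≢ _ = inj₁ (inj₂ (inj₁ (q> , r≢)))

  -- The order of the two pairs decides which clause of `Beats` applies, so both wins are by the
  -- same clause; given `r i`, each clause leaves one value for `r j`.
  beats-injectiveʳ : ∀ {i j k} → Beats i j → Beats i k → q j ≡ q k → j ≡ k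
  beats-injectiveʳ (inj₁ (_ , a)) (inj₁ (_ , b)) q≡ = qr-injective q≡ (trans (sym a) b)
  beats-injectiveʳ {i} (inj₁ (a , _)) (inj₂ (inj₁ (b , _))) q≡ =
    contradiction b (Finₚ.<-asym (subst (q i Fin.<_) q≡ a))
  beats-injectiveʳ (inj₁ (a , _)) (inj₂ (inj₂ (b , _))) q≡ = contradiction a (Finₚ.<-irrefl (trans b (sym q≡)))
  beats-injectiveʳ {i} (inj₂ (inj₁ (a , _))) (inj₁ (b , _)) q≡ =
    contradiction b (Finₚ.<-asym (subst (Fin._< q i) q≡ a))
  beats-injectiveʳ (inj₂ (inj₁ (_ , a))) (inj₂ (inj₁ (_ , b))) q≡ = qr-injective q≡ (Fin2-≢-unique a b)
  beats-injectiveʳ (inj₂ (inj₁ (a , _))) (inj₂ (inj₂ (b , _))) q≡ = contradiction a (Finₚ.<-irrefl (trans q≡ (sym b)))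
  beats-injectiveʳ (inj₂ (inj₂ (a , _))) (inj₁ (b , _)) q≡ = contradiction b (Finₚ.<-irrefl (trans a q≡))
  beats-injectiveʳ (inj₂ (inj₂ (a , _))) (inj₂ (inj₁ (b , _))) q≡ = contradiction b (Finₚ.<-irrefl (sym (trans a q≡)))
  beats-injectiveʳ (inj₂ (inj₂ (_ , a))) (inj₂ (inj₂ (_ , b))) q≡ =
    qr-injective q≡ (Fin2-≢-unique (λ e → Finₚ.<-irrefl e a) (λ e → Finₚ.<-irrefl e b))

  beats-injectiveˡ : ∀ {i j k} → Beats j i → Beats k i → q j ≡ q k → j ≡ k
  beats-injectiveˡ (inj₁ (_ , a)) (inj₁ (_ , b)) q≡ = qr-injective q≡ (trans a (sym b))
  beats-injectiveˡ {i} (inj₁ (a , _)) (inj₂ (inj₁ (b , _))) q≡ =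
    contradiction b (Finₚ.<-asym (subst (Fin._< q i) q≡ a))
  beats-injectiveˡ (inj₁ (a , _)) (inj₂ (inj₂ (b , _))) q≡ = contradiction a (Finₚ.<-irrefl (trans q≡ b))
  beats-injectiveˡ {i} (inj₂ (inj₁ (a , _))) (inj₁ (b , _)) q≡ =
    contradiction b (Finₚ.<-asym (subst (q i Fin.<_) q≡ a))
  beats-injectiveˡ (inj₂ (inj₁ (_ , a))) (inj₂ (inj₁ (_ , b))) q≡ =
    qr-injective q≡ (Fin2-≢-unique (a ∘ sym) (b ∘ sym))
  beats-injectiveˡ (inj₂ (inj₁ (a , _))) (inj₂ (inj₂ (b , _))) q≡ = contradiction a (Finₚ.<-irrefl (sym (trans q≡ b)))
  beats-injectiveˡ (inj₂ (inj₂ (a , _))) (inj₁ (b , _)) q≡ = contradiction b (Finₚ.<-irrefl (trans (sym q≡) a))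
  beats-injectiveˡ (inj₂ (inj₂ (a , _))) (inj₂ (inj₁ (b , _))) q≡ = contradiction b (Finₚ.<-irrefl (trans (sym a) q≡))
  beats-injectiveˡ (inj₂ (inj₂ (_ , a))) (inj₂ (inj₂ (_ , b))) q≡ =
    qr-injective q≡ (Fin2-≢-unique (λ e → Finₚ.<-irrefl (sym e) a) (λ e → Finₚ.<-irrefl (sym e) b))

  matches : List (Fin (h * 2) × Fin (h * 2))
  matches = filter (uncurry beats?) (cartesianProduct (allFin _) (allFin _))

  matches-unique : Unique matches
  matches-unique = filter⁺ _ (cartesianProduct⁺ (allFin⁺ _) (allFin⁺ _))

  matches-beats : All (uncurry Beats) matches
  matches-beats = all-filter _ (cartesianProduct (allFin _) (allFin _))

  ∈-matches : ∀ {i j} → Beats i j → (i , j) ∈ matches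
  ∈-matches {i} {j} = ∈-filter⁺ (uncurry beats?) (∈-cartesianProduct⁺ (∈-allFin i) (∈-allFin j))

  -- The beaten opponents lie in different pairs, of which there are h. `L` is arbitrary because the
  -- bound serves every stage of the play.
  wins-≤ : ∀ {L} → Unique L → All (uncurry Beats) L → ∀ k → length (filter (λ p → proj₁ p ≟ k) L) ≤ h
  wins-≤ {L} unique beats k = length-injective-≤ (q ∘ proj₂) (filter⁺ k? unique) injective
    where
    k? = λ p → proj₁ p ≟ k
    injective : ∀ {x y} → x ∈ filter k? L → y ∈ filter k? L → q (proj₂ x) ≡ q (proj₂ y) → x ≡ y
    injective x∈ y∈ eq with ∈-filter⁻ k? {xs = L} x∈ | ∈-filter⁻ k? {xs = L} y∈
    ... | x∈L , refl | y∈L , refl =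
      cong (k ,_) (beats-injectiveʳ (All.lookup beats x∈L) (All.lookup beats y∈L) eq)

  losses-≤ : ∀ {L} → Unique L → All (uncurry Beats) L → ∀ k → length (filter (λ p → proj₂ p ≟ k) L) ≤ h
  losses-≤ {L} unique beats k = length-injective-≤ (q ∘ proj₁) (filter⁺ k? unique) injective
    where
    k? = λ p → proj₂ p ≟ k
    injective : ∀ {x y} → x ∈ filter k? L → y ∈ filter k? L → q (proj₁ x) ≡ q (proj₁ y) → x ≡ y
    injective x∈ y∈ eq with ∈-filter⁻ k? {xs = L} x∈ | ∈-filter⁻ k? {xs = L} y∈
    ... | x∈L , refl | y∈L , refl =
      cong (_, k) (beats-injectiveˡ (All.lookup beats x∈L) (All.lookup beats y∈L) eq)

-- Rooted trees and exchanges of two values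

-- Rooted trees are given by their parent function, with the root as its own parent.
data Reach {A : Set} (p : A → A) (root : A) : A → Set where
  here : Reach p root root
  step : ∀ {u} → u ≢ root → Reach p root (p u) → Reach p root u

reach-child : ∀ {A : Set} {p : A → A} {root u} w → u ≢ root → p u ≡ w → Reach p root w → Reach p root u
reach-child _ u≢root refl = step u≢root

-- Follow the old path to the root, inside `P`, until it meets a vertex already known to reach the
-- root along `q`.
reach-transfer : ∀ {A : Set} {p q : A → A} {root} (P : A → Set) →
  (∀ u → P u → P (p u)) → (∀ u → P u → Reach q root u ⊎ q u ≡ p u) →
  ∀ {u} → P u → Reach p root u → Reach q root u
reach-transfer P closed change Pu here = here
reach-transfer P closed change {u} Pu (step u≢root r) with change u Pu
... | inj₁ r′ = r′
... | inj₂ eq = reach-child _ u≢root eq (reach-transfer P closed change (closed u Pu) r)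

opaque
  swap : Fin n → Fin n → Permutation′ n → Permutation′ n
  swap α β π = transpose α β ∘ₚ π

  swap-first : ∀ (α β : Fin n) π → swap α β π ⟨$⟩ʳ α ≡ π ⟨$⟩ʳ β
  swap-first α β π with α ≟ α
  ... | yes _  = refl
  ... | no α≢α = contradiction refl α≢α

  swap-second : ∀ (α β : Fin n) π → swap α β π ⟨$⟩ʳ β ≡ π ⟨$⟩ʳ α
  swap-second α β π with β ≟ α
  ... | yes refl = refl
  ... | no _ with β ≟ β
  ...   | yes _  = refl
  ...   | no β≢β = contradiction refl β≢β

  swap-other : ∀ (α β : Fin n) π {u} → u ≢ α → u ≢ β → swap α β π ⟨$⟩ʳ u ≡ π ⟨$⟩ʳ u
  swap-other α β π {u} u≢α u≢β with u ≟ α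
  ... | yes u≡α = contradiction u≡α u≢α
  ... | no _ with u ≟ β
  ...   | yes u≡β = contradiction u≡β u≢β
  ...   | no _    = refl

swap-elim : ∀ (α β : Fin n) π (P : Fin n → Fin n → Set) →
  P α (π ⟨$⟩ʳ β) → P β (π ⟨$⟩ʳ α) → (∀ u → u ≢ α → u ≢ β → P u (π ⟨$⟩ʳ u)) →
  ∀ u → P u (swap α β π ⟨$⟩ʳ u)
swap-elim α β π P Pα Pβ other u = cases (u ≟ α) (u ≟ β)
  where
  cases : Dec (u ≡ α) → Dec (u ≡ β) → P u (swap α β π ⟨$⟩ʳ u)
  cases (yes refl) _          = subst (P α) (sym (swap-first α β π)) Pα
  cases (no _)     (yes refl) = subst (P β) (sym (swap-second α β π)) Pβ
  cases (no u≢α)   (no u≢β)   = subst (P u) (sym (swap-other α β π u≢α u≢β)) (other u u≢α u≢β)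

permutation-injective : ∀ (π : Permutation′ n) {u w} → π ⟨$⟩ʳ u ≡ π ⟨$⟩ʳ w → u ≡ w
permutation-injective π eq = trans (sym (inverseˡ π)) (trans (cong (π ⟨$⟩ˡ_) eq) (inverseˡ π))

-- Trees in a symmetric Latin square

-- The inverse of a row finds the neighbour along a colour; `0#` is the colour of the loops.
record SymmetricLatinSquare (n : ℕ) : Set where
  field
    row      : Fin n → Permutation′ n
    row-sym  : ∀ u w → row u ⟨$⟩ʳ w ≡ row w ⟨$⟩ʳ u
    0#       : Fin n
    row-diag : ∀ u → row u ⟨$⟩ʳ u ≡ 0#

module Trees (square : SymmetricLatinSquare n) {t : ℕ} (v : Fin t → Fin n)
             (v-injective : ∀ {k l} → v k ≡ v l → k ≡ l) where

  open SymmetricLatinSquare square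

  col : Fin n → Fin n → Fin n
  col u w = row u ⟨$⟩ʳ w

  nb : Fin n → Fin n → Fin n
  nb u b = row u ⟨$⟩ˡ b

  col-nb : ∀ u b → col u (nb u b) ≡ b
  col-nb u b = inverseʳ (row u)

  nb-col : ∀ u w → nb u (col u w) ≡ w
  nb-col u w = inverseˡ (row u)

  -- By symmetry of the square an edge has the same colour from both ends, so each colour acts as an
  -- involution.
  nb-nb : ∀ u b → nb (nb u b) b ≡ u
  nb-nb u b = trans (cong (nb (nb u b)) (sym (trans (row-sym (nb u b) u) (col-nb u b)))) (nb-col (nb u b) u)

  nb-flip : ∀ {u b w} → nb u b ≡ w → nb w b ≡ u
  nb-flip {u} {b} refl = nb-nb u b

  nb⇒col : ∀ {u b w} → nb u b ≡ w → col u w ≡ b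
  nb⇒col {u} {b} refl = col-nb u b

  col⇒nb : ∀ {u b w} → col u w ≡ b → nb u b ≡ w
  col⇒nb {u} {b} {w} refl = nb-col u w

  nb-injective : ∀ u {b d} → nb u b ≡ nb u d → b ≡ d
  nb-injective u {b} {d} eq = trans (sym (col-nb u b)) (trans (cong (col u) eq) (col-nb u d))

  nb-0# : ∀ u → nb u 0# ≡ u
  nb-0# u = col⇒nb (row-diag u)

  Nonroot : Fin n → Set
  Nonroot u = ∀ k → u ≢ v k

  roots : List (Fin n)
  roots = map v (allFin t)

  ∉-roots : ∀ {u} → u ∉ roots → Nonroot u
  ∉-roots u∉ k refl = u∉ (∈-map⁺ v (∈-allFin k))

  length-roots : length roots ≡ t
  length-roots = trans (length-map v (allFin t)) (length-tabulate {n = t} (λ k → k))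

  -- π stands for the graph joining every u to its neighbour in colour π u, which is rainbow as π
  -- is injective.
  par : Permutation′ n → Fin n → Fin n
  par π u = nb u (π ⟨$⟩ʳ u)

  par-col : ∀ π u → π ⟨$⟩ʳ u ≡ col u (par π u)
  par-col π u = sym (col-nb u _)

  -- Two trees can share an edge in the same direction, from one child `u`, or in opposite
  -- directions. The second is tolerated only between the two roots: the initial stars share that
  -- edge, and one of the trees gives it up later.
  record Disjoint (r : Fin n) (π : Permutation′ n) (s : Fin n) (ρ : Permutation′ n) : Set where
    field
      arcs-differ  : ∀ u → π ⟨$⟩ʳ u ≢ ρ ⟨$⟩ʳ u
      antiparallel : ∀ u → par π (par ρ u) ≡ u → u ≡ r × par ρ u ≡ s

  open Disjoint public

  Disjoint-sym : ∀ {r π s ρ} → Disjoint r π s ρ → Disjoint s ρ r π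
  Disjoint-sym {r} {π} {s} {ρ} d = record
    { arcs-differ  = λ u eq → arcs-differ d u (sym eq)
    ; antiparallel = λ u eq →
        let a , b = antiparallel d (par π u) (cong (par π) eq)
        in trans (sym eq) b , a
    }

  par-swap-first : ∀ α β π → par (swap α β π) α ≡ nb α (π ⟨$⟩ʳ β)
  par-swap-first α β π = cong (nb α) (swap-first α β π)

  par-swap-second : ∀ α β π → par (swap α β π) β ≡ nb β (π ⟨$⟩ʳ α)
  par-swap-second α β π = cong (nb β) (swap-second α β π)

  par-swap-other : ∀ α β π {u} → u ≢ α → u ≢ β → par (swap α β π) u ≡ par π u
  par-swap-other α β π {u} u≢α u≢β = cong (nb u) (swap-other α β π u≢α u≢β)

  -- The exchange creates an edge from `α` in colour `π β` and one from `β` in colour `π α`. The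
  -- first two inequalities keep `ρ` from using them in the same direction, the last two from using
  -- them from the far end.
  swap-disjoint : ∀ {r π s ρ} α β → Disjoint r π s ρ →
    π ⟨$⟩ʳ β ≢ ρ ⟨$⟩ʳ α → π ⟨$⟩ʳ α ≢ ρ ⟨$⟩ʳ β →
    ρ ⟨$⟩ʳ nb α (π ⟨$⟩ʳ β) ≢ π ⟨$⟩ʳ β → ρ ⟨$⟩ʳ nb β (π ⟨$⟩ʳ α) ≢ π ⟨$⟩ʳ α →
    Disjoint r (swap α β π) s ρ
  swap-disjoint {r} {π} {s} {ρ} α β d α-free β-free α′-free β′-free = record
    { arcs-differ = arcs ; antiparallel = anti }
    where
    arcs : ∀ u → swap α β π ⟨$⟩ʳ u ≢ ρ ⟨$⟩ʳ u
    arcs = swap-elim α β π (λ u b → b ≢ ρ ⟨$⟩ʳ u) α-free β-free (λ u _ _ → arcs-differ d u)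
    coloured : ∀ {w u b} → par ρ u ≡ w → nb w b ≡ u → ρ ⟨$⟩ʳ nb w b ≡ b
    coloured {w} {u} {b} ρu≡w refl =
      trans (par-col ρ u) (trans (cong (col u) ρu≡w) (trans (row-sym u w) (col-nb w b)))
    anti : ∀ u → par (swap α β π) (par ρ u) ≡ u → u ≡ r × par ρ u ≡ s
    anti u = swap-elim α β π (λ w b → par ρ u ≡ w → nb w b ≡ u → u ≡ r × par ρ u ≡ s)
      (λ e eq → contradiction (coloured e eq) α′-free)
      (λ e eq → contradiction (coloured e eq) β′-free)
      (λ { _ _ _ refl eq → antiparallel d u eq })
      (par ρ u) refl

  Matches : Set
  Matches = List (Fin t × Fin t)

  wins losses : Fin t → Matches → Matches
  wins   k = filter (λ p → proj₁ p ≟ k)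
  losses k = filter (λ p → proj₂ p ≟ k)

  -- A pair (m , k) of M means that tree k has given up the edge between the roots m and k.
  record Tree (M : Matches) (s : ℕ) (k : Fin t) (π : Permutation′ n) : Set where
    field
      root-colour     : π ⟨$⟩ʳ v k ≡ 0#
      reach           : ∀ u → Reach (par π) (v k) u
      -- All other roots are leaves, so rehanging one of them cuts off nothing.
      only-root       : ∀ m u → par π u ≡ v m → k ≡ m
      kept            : ∀ m → (m , k) ∉ M → par π (v m) ≡ v k
      lost            : ∀ m → (m , k) ∈ M → par π (v m) ≢ v k
      -- A non-root outside this list is a child of `v k`, which makes it a safe new parent.
      moved           : List (Fin n)
      moved-complete  : ∀ u → Nonroot u → par π u ≢ v k → u ∈ moved
      length-moved    : length moved ≤ s

  open Tree public

  -- By `row-sym`, the row of `v k` gives every `u` the colour of its edge to `v k`, so every parent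
  -- is `v k`.
  star : ∀ k → Tree [] 0 k (row (v k))
  star k = record
    { root-colour    = row-diag (v k)
    ; reach          = star-reach
    ; only-root      = λ m u eq → v-injective (trans (sym (par-star u)) eq)
    ; kept           = λ m _ → par-star (v m)
    ; lost           = λ _ ()
    ; moved          = []
    ; moved-complete = λ u _ u≢ → contradiction (par-star u) u≢
    ; length-moved   = z≤n
    }
    where
    par-star : ∀ u → par (row (v k)) u ≡ v k
    par-star u = trans (cong (nb u) (row-sym (v k) u)) (nb-col u (v k))
    star-reach : ∀ u → Reach (par (row (v k))) (v k) u
    star-reach u with u ≟ v k
    ... | yes refl = here
    ... | no u≢v   = reach-child _ u≢v (par-star u) here

  star-disjoint : ∀ {k l} → k ≢ l → Disjoint (v k) (row (v k)) (v l) (row (v l))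
  star-disjoint {k} {l} k≢l = record
    { arcs-differ  = λ u eq → k≢l (v-injective (permutation-injective (row u)
        (trans (row-sym u (v k)) (trans eq (row-sym (v l) u)))))
    ; antiparallel = λ u eq → trans (sym eq) (par-star k _) , par-star l u
    }
    where
    par-star : ∀ k u → par (row (v k)) u ≡ v k
    par-star k u = trans (cong (nb u) (row-sym (v k) u)) (nb-col u (v k))

  par-root : ∀ {M s k π} → Tree M s k π → par π (v k) ≡ v k
  par-root T = trans (cong (nb _) (root-colour T)) (nb-0# _)

-- Exchanges that preserve trees

module Exchange {n} (square : SymmetricLatinSquare n) {t : ℕ} (v : Fin t → Fin n)
             (v-injective : ∀ {k l} → v k ≡ v l → k ≡ l) where
  open SymmetricLatinSquare square
  open Trees square v v-injective

  unmoved : ∀ {M s k π u} (T : Tree M s k π) → Nonroot u → u ∉ moved T → par π u ≡ v k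
  unmoved T u-nonroot u∉ = decidable-stable (_ ≟ _) λ moves → u∉ (moved-complete T _ u-nonroot moves)

  nonzero : ∀ {M s k π u} → Tree M s k π → u ≢ v k → π ⟨$⟩ʳ u ≢ 0#
  nonzero {π = π} T u≢v eq = u≢v (permutation-injective π (trans eq (sym (root-colour T))))

  nb-≢ : ∀ {u b} → b ≢ 0# → nb u b ≢ u
  nb-≢ {u} b≢0 eq = b≢0 (trans (sym (nb⇒col eq)) (row-diag u))

  -- Both new parents were children of `v i`. So `y′` reaches the root through `q`, and `y` through
  -- `p`; any other path is kept until it meets `y` or `y′`.
  replace-child : ∀ {M s i π} (T : Tree M s i π) y y′ → Nonroot y → Nonroot y′ → par π y ≡ v i →
    let p = nb y (π ⟨$⟩ʳ y′) ; q = nb y′ (π ⟨$⟩ʳ y) in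
    Nonroot p → p ∉ moved T → Nonroot q → q ∉ moved T →
    Tree M (2 + s) i (swap y y′ π)
  replace-child {M} {s} {i} {π} T y y′ y-nonroot y′-nonroot child p-nonroot p∉ q-nonroot q∉ = record
    { root-colour    = trans (swap-other y y′ π (y-nonroot i ∘ sym) (y′-nonroot i ∘ sym)) (root-colour T)
    ; reach          = λ u → reach-transfer (λ _ → ⊤) (λ _ _ → tt) (λ w _ → change w) tt (reach T u)
    ; only-root      = λ m → swap-elim y y′ π (λ u b → nb u b ≡ v m → i ≡ m)
        (λ eq → contradiction eq (p-nonroot m))
        (λ eq → contradiction eq (q-nonroot m))
        (λ u _ _ → only-root T m u)
    ; kept           = λ m m∉ → trans (root-unchanged m) (kept T m m∉)
    ; lost           = λ m m∈ eq → lost T m m∈ (trans (sym (root-unchanged m)) eq)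
    ; moved          = y ∷ y′ ∷ moved T
    ; moved-complete = swap-elim y y′ π (λ u b → Nonroot u → nb u b ≢ v i → u ∈ y ∷ y′ ∷ moved T)
        (λ _ _ → here refl)
        (λ _ _ → there (here refl))
        (λ u _ _ nonroot moves → there (there (moved-complete T u nonroot moves)))
    ; length-moved   = s≤s (s≤s (length-moved T))
    }
    where
    π′ = swap y y′ π
    p = nb y (π ⟨$⟩ʳ y′)
    q = nb y′ (π ⟨$⟩ʳ y)
    root-unchanged : ∀ m → par π′ (v m) ≡ par π (v m)
    root-unchanged m = par-swap-other y y′ π (y-nonroot m ∘ sym) (y′-nonroot m ∘ sym)
    p≢y : p ≢ y
    p≢y = nb-≢ (nonzero T (y′-nonroot i))
    q≢y′ : q ≢ y′
    q≢y′ = nb-≢ (nonzero T (y-nonroot i))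
    -- Otherwise the edge from `y` in its old colour would end at `y′`, but it ends at `v i`.
    q≢y : q ≢ y
    q≢y eq = y′-nonroot i (trans (sym (nb-flip eq)) child)
    reach-q : Reach (par π′) (v i) q
    reach-q = reach-child _ (q-nonroot i)
      (trans (par-swap-other y y′ π q≢y q≢y′) (unmoved T q-nonroot q∉)) here
    reach-y′ : Reach (par π′) (v i) y′
    reach-y′ = reach-child q (y′-nonroot i) (par-swap-second y y′ π) reach-q
    reach-p : Reach (par π′) (v i) p
    reach-p with p ≟ y′
    -- The two new edges may form one path from `y` through `y′` and `q`.
    ... | yes eq = subst (Reach (par π′) (v i)) (sym eq) reach-y′
    ... | no p≢y′ = reach-child _ (p-nonroot i)
      (trans (par-swap-other y y′ π p≢y p≢y′) (unmoved T p-nonroot p∉)) here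
    reach-y : Reach (par π′) (v i) y
    reach-y = reach-child p (y-nonroot i) (par-swap-first y y′ π) reach-p
    change : ∀ w → Reach (par π′) (v i) w ⊎ par π′ w ≡ par π w
    change w with w ≟ y | w ≟ y′
    ... | yes refl | _        = inj₁ reach-y
    ... | no _     | yes refl = inj₁ reach-y′
    ... | no ≢y    | no ≢y′   = inj₂ (par-swap-other y y′ π ≢y ≢y′)

  -- Now `x` hangs from `z`, a child of `v j`, and the leaf `v i` hangs from `y`, whose path avoids
  -- `v i`. Only `x` joins `moved`, since `v i` is a root.
  give-up-root : ∀ {M s i j π} (T : Tree M s j π) x → i ≢ j → (i , j) ∉ M → Nonroot x →
    let y = nb (v i) (π ⟨$⟩ʳ x) ; z = nb x (π ⟨$⟩ʳ v i) in
    Nonroot y → Nonroot z → z ∉ moved T →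
    Tree ((i , j) ∷ M) (1 + s) j (swap (v i) x π)
  give-up-root {M} {s} {i} {j} {π} T x i≢j ij∉ x-nonroot y-nonroot z-nonroot z∉ = record
    { root-colour    = trans (swap-other (v i) x π vj≢vi (x-nonroot j ∘ sym)) (root-colour T)
    ; reach          = λ u → reach-any u (u ≟ v i)
    ; only-root      = λ m → swap-elim (v i) x π (λ u b → nb u b ≡ v m → j ≡ m)
        (λ eq → contradiction eq (y-nonroot m))
        (λ eq → contradiction eq (z-nonroot m))
        (λ u _ _ → only-root T m u)
    ; kept           = λ m mj∉ → trans
        (root-unchanged m (λ { refl → mj∉ (here refl) }))
        (kept T m (mj∉ ∘ there))
    ; lost           = lost′
    ; moved          = x ∷ moved T
    ; moved-complete = swap-elim (v i) x π (λ u b → Nonroot u → nb u b ≢ v j → u ∈ x ∷ moved T)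
        (λ nonroot _ → contradiction refl (nonroot i))
        (λ _ _ → here refl)
        (λ u _ _ nonroot moves → there (moved-complete T u nonroot moves))
    ; length-moved   = s≤s (length-moved T)
    }
    where
    π′ = swap (v i) x π
    y = nb (v i) (π ⟨$⟩ʳ x)
    z = nb x (π ⟨$⟩ʳ v i)
    vi≢vj : v i ≢ v j
    vi≢vj = i≢j ∘ v-injective
    vj≢vi : v j ≢ v i
    vj≢vi = vi≢vj ∘ sym
    root-unchanged : ∀ m → m ≢ i → par π′ (v m) ≡ par π (v m)
    root-unchanged m m≢i = par-swap-other (v i) x π (m≢i ∘ v-injective) (x-nonroot m ∘ sym)
    lost′ : ∀ m → (m , j) ∈ (i , j) ∷ M → par π′ (v m) ≢ v j
    lost′ m (here refl) eq = y-nonroot j (trans (sym (par-swap-first (v i) x π)) eq)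
    lost′ m (there m∈)  eq = lost T m m∈ (trans (sym (root-unchanged m λ { refl → ij∉ m∈ })) eq)
    z≢x : z ≢ x
    z≢x = nb-≢ (nonzero T vi≢vj)
    reach-z : Reach (par π′) (v j) z
    reach-z = reach-child _ (z-nonroot j)
      (trans (par-swap-other (v i) x π (z-nonroot i) z≢x) (unmoved T z-nonroot z∉)) here
    reach-x : Reach (par π′) (v j) x
    reach-x = reach-child z (x-nonroot j) (par-swap-second (v i) x π) reach-z
    change : ∀ w → w ≢ v i → Reach (par π′) (v j) w ⊎ par π′ w ≡ par π w
    change w w≢vi with w ≟ x
    ... | yes refl = inj₁ reach-x
    ... | no w≢x   = inj₂ (par-swap-other (v i) x π w≢vi w≢x)
    -- The root v i is a leaf of tree j, so no other vertex reached v j through it.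
    reach-other : ∀ {u} → u ≢ v i → Reach (par π′) (v j) u
    reach-other {u} u≢vi = reach-transfer (_≢ v i)
      (λ w _ eq → i≢j (sym (only-root T i w eq))) change u≢vi (reach T u)
    reach-any : ∀ u → Dec (u ≡ v i) → Reach (par π′) (v j) u
    reach-any u (yes refl) = reach-child y vi≢vj (par-swap-first (v i) x π) (reach-other (y-nonroot i))
    reach-any u (no u≢vi)  = reach-other u≢vi

  extend-matches : ∀ {M s i j k π} → Tree M s k π → k ≢ j → Tree ((i , j) ∷ M) s k π
  extend-matches T k≢j = record
    { root-colour    = root-colour T
    ; reach          = reach T
    ; only-root      = only-root T
    ; kept           = λ m mk∉ → kept T m (mk∉ ∘ there)
    ; lost           = λ { m (here refl) → contradiction refl k≢j ; m (there mk∈) → lost T m mk∈ }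
    ; moved          = moved T
    ; moved-complete = moved-complete T
    ; length-moved   = length-moved T
    }

  tree-≤ : ∀ {M s s′ k π} → s ≤ s′ → Tree M s k π → Tree M s′ k π
  tree-≤ s≤s′ T = record
    { root-colour    = root-colour T
    ; reach          = reach T
    ; only-root      = only-root T
    ; kept           = kept T
    ; lost           = lost T
    ; moved          = moved T
    ; moved-complete = moved-complete T
    ; length-moved   = ≤-trans (length-moved T) s≤s′
    }

  -- Bounds the moved vertices: a loss exchanges a root with one other vertex, and a win may force
  -- an exchange of two vertices that are not roots.
  weight : Fin t → Matches → ℕ
  weight k M = length (losses k M) + 2 * length (wins k M)

  record State (M : Matches) (κ : Fin t → Permutation′ n) : Set where
    field
      tree     : ∀ k → Tree M (weight k M) k (κ k)
      disjoint : ∀ {k l} → k ≢ l → Disjoint (v k) (κ k) (v l) (κ l)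

  open State public

  length-filter-∷ : ∀ {A : Set} {P : A → Set} (P? : ∀ x → Dec (P x)) x xs →
    length (filter P? xs) ≤ length (filter P? (x ∷ xs))
  length-filter-∷ P? x xs with P? x
  ... | yes _ = ℕₚ.n≤1+n _
  ... | no _  = ≤-refl

  weight-∷ : ∀ k p M → weight k M ≤ weight k (p ∷ M)
  weight-∷ k p M = +-mono-≤ (length-filter-∷ (λ p → proj₂ p ≟ k) p M)
    (ℕₚ.*-monoʳ-≤ 2 (length-filter-∷ (λ p → proj₁ p ≟ k) p M))

  weight-loss : ∀ i j M → 1 + weight j M ≤ weight j ((i , j) ∷ M)
  weight-loss i j M = +-mono-≤ (≤-reflexive (sym (cong length (filter-accept (λ p → proj₂ p ≟ j) {i , j} {M} refl))))
    (ℕₚ.*-monoʳ-≤ 2 (length-filter-∷ (λ p → proj₁ p ≟ j) (i , j) M))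

  weight-win : ∀ i j M → 2 + weight i M ≤ weight i ((i , j) ∷ M)
  weight-win i j M = ≤-trans (≤-reflexive eq) (+-mono-≤ (length-filter-∷ (λ p → proj₂ p ≟ i) (i , j) M)
    (≤-reflexive (cong (2 *_) (sym (cong length (filter-accept (λ p → proj₁ p ≟ i) {i , j} {M} refl))))))
    where
    eq : 2 + weight i M ≡ length (losses i M) + 2 * suc (length (wins i M))
    eq = trans (ℕₚ.+-comm 2 (weight i M)) (trans (ℕₚ.+-assoc (length (losses i M)) _ 2)
      (cong₂ _+_ {x = length (losses i M)} refl (trans (ℕₚ.+-comm _ 2) (sym (ℕₚ.*-suc 2 _)))))

-- One round: the loser gives up an edge, the winner makes room

module Round {n} (square : SymmetricLatinSquare n) {h : ℕ} (v : Fin (h * 2) → Fin n)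
             (v-injective : ∀ {k l} → v k ≡ v l → k ≡ l) (n-large : 1 + 18 * h < n) where
  open SymmetricLatinSquare square
  open Trees square v v-injective
  open Exchange square v v-injective

  private
    t = h * 2

  length-allFin : length (allFin t) ≡ t
  length-allFin = length-tabulate {n = t} (λ k → k)

  module _ {M κ} (S : State M κ) (few-wins : ∀ k → length (wins k M) ≤ h)
           (few-losses : ∀ k → length (losses k M) ≤ h) where

    private
      N : Fin t → List (Fin n)
      N k = moved (tree S k)

      length-N : ∀ k → length (N k) ≤ h + 2 * h
      length-N k = ≤-trans (length-moved (tree S k)) (+-mono-≤ (few-losses k) (ℕₚ.*-monoʳ-≤ 2 (few-wins k)))

    -- The neighbours of v i outside tree i to which v i has already been attached.
    taken : Fin t → List (Fin n)
    taken i = map (λ p → par (κ (proj₂ p)) (v i)) (wins i M)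

    -- When tree i replaces its edge from v i to y by exchanging the colours of y and y′, one of the
    -- two new edges lies in another tree only if (y , y′) is listed here.
    module Conflicts (i : Fin t) where

      conflicts-at : Fin t → Fin n → List (Fin n × Fin n)
      -- The edge from `u` in tree `k` can be the new edge at `y` only if its colour is that of `y′`
      -- in tree `i` and `y` is one of its ends. It can be the new edge at `y′` only if its colour
      -- leads from `v i` to `y` and `y′` is one of its ends.
      conflicts-at k u = (u , κ i ⟨$⟩ˡ (κ k ⟨$⟩ʳ u)) ∷ (par (κ k) u , κ i ⟨$⟩ˡ (κ k ⟨$⟩ʳ u))
        ∷ (nb (v i) (κ k ⟨$⟩ʳ u) , u) ∷ (nb (v i) (κ k ⟨$⟩ʳ u) , par (κ k) u) ∷ []

      conflicts : List (Fin n × Fin n)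
      conflicts = concatMap (λ k → concatMap (conflicts-at k) (N k)) (allFin t)

      -- There are 2h trees, at most 3h moved vertices in each and four entries for each of these:
      -- at most 24h² entries. The form 4h(6h + 1) leaves at most 4h crowded `y` in the double
      -- counting.
      length-conflicts : length conflicts ≤ (h * 4) * suc (6 * h)
      length-conflicts = ≤-trans
        (length-concatMap-≤ (λ k → concatMap (conflicts-at k) (N k)) ((h + 2 * h) * 4) (allFin t) λ k → ≤-trans
          (length-concatMap-≤ (conflicts-at k) 4 (N k) λ _ → ≤-refl) (ℕₚ.*-monoˡ-≤ 4 (length-N k)))
        (≤-trans (≤-reflexive (cong (_* ((h + 2 * h) * 4)) length-allFin))
          (≤-trans (ℕₚ.m≤n+m _ (h * 4)) (≤-reflexive (arith h))))
        where
        arith : ∀ h → h * 4 + h * 2 * ((h + 2 * h) * 4) ≡ h * 4 * suc (6 * h)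
        arith = solve-∀

      -- An edge between two vertices that are not roots does not end at `v k`, so its child `u` was
      -- moved. Hence listing moved vertices suffices.
      ∈-conflicts : ∀ {k u r} → Nonroot u → Nonroot (par (κ k) u) → r ∈ conflicts-at k u → r ∈ conflicts
      ∈-conflicts {k} {u} u-nonroot par-nonroot r∈ = ∈-concatMap (∈-allFin k)
        (∈-concatMap {f = conflicts-at k} (moved-complete (tree S k) u u-nonroot (par-nonroot k)) r∈)

      crowded = few-large-fibres (6 * h) (h * 4) conflicts length-conflicts

    -- Here `v i` is to hang from `y` in colour `b`, and `x` from `z` in colour `a`. The fields keep
    -- both edges out of all trees, except that tree `i` may contain the one between `y` and `v i`;
    -- `y-uncrowded` then makes a repair possible.
    record ReleaseChoice (i j : Fin t) : Set where
      field
        x : Fin n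
        x-nonroot : Nonroot x
      a = κ j ⟨$⟩ʳ v i
      b = κ j ⟨$⟩ʳ x
      y = nb (v i) b
      z = nb x a
      field
        y-nonroot : Nonroot y
        z-nonroot : Nonroot z
        z-unmoved : z ∉ N j
        x-free    : ∀ k → κ k ⟨$⟩ʳ x ≢ a
        z-free    : ∀ k → κ k ⟨$⟩ʳ z ≢ a
        y-free    : y ∉ taken i
        y-uncrowded : length (fibre y (Conflicts.conflicts i)) ≤ 6 * h

    -- With `a` fixed, `z` determines `x`; and `y` determines `b`, hence `x`. The excluded `x`
    -- number 2h as roots, 5h for `z` as a root or moved vertex, 2h each for `x-free` and `z-free`,
    -- and 7h for `y` as a root, taken or crowded.
    choose-release : ∀ i j → ReleaseChoice i j
    choose-release i j = record
      { x           = x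
      ; x-nonroot   = ∉-roots (x∉ ∘ ∈-++⁺ˡ)
      ; y-nonroot   = ∉-roots (y∉ ∘ ∈-++⁺ˡ)
      ; z-nonroot   = ∉-roots (z∉ ∘ ∈-++⁺ˡ)
      ; z-unmoved   = z∉ ∘ ∈-++⁺ʳ roots
      ; x-free      = λ k eq → x∉ (∈-++⁺ʳ roots (∈-++⁺ʳ bad₂ (∈-++⁺ˡ (subst (_∈ bad₃)
          (trans (cong (κ k ⟨$⟩ˡ_) (sym eq)) (inverseˡ (κ k))) (∈-map⁺ _ (∈-allFin k))))))
      ; z-free      = λ k eq → x∉ (∈-++⁺ʳ roots (∈-++⁺ʳ bad₂ (∈-++⁺ʳ bad₃ (∈-++⁺ˡ (subst (_∈ bad₄)
          (trans (cong (λ w → nb w a) (trans (cong (κ k ⟨$⟩ˡ_) (sym eq)) (inverseˡ (κ k)))) (nb-nb x a))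
          (∈-map⁺ _ (∈-allFin k)))))))
      ; y-free      = y∉ ∘ ∈-++⁺ʳ roots ∘ ∈-++⁺ˡ
      ; y-uncrowded = proj₂ (proj₂ crowded) y (y∉ ∘ ∈-++⁺ʳ roots ∘ ∈-++⁺ʳ (taken i))
      }
      where
      open Conflicts i
      a = κ j ⟨$⟩ʳ v i
      H = proj₁ crowded
      -- The only `x` for which `y` would be `w`.
      released : Fin n → Fin n
      released w = κ j ⟨$⟩ˡ col (v i) w
      bad₂ = map (λ w → nb w a) (roots ++ N j)
      bad₃ = map (λ k → κ k ⟨$⟩ˡ a) (allFin t)
      bad₄ = map (λ k → nb (κ k ⟨$⟩ˡ a) a) (allFin t)
      bad₅ = map released (roots ++ taken i ++ H)
      bad = roots ++ bad₂ ++ bad₃ ++ bad₄ ++ bad₅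
      roots≤ : length roots ≤ t
      roots≤ = ≤-reflexive length-roots
      arith : ∀ h → h * 2 + ((h * 2 + (h + 2 * h)) + (h * 2 + (h * 2 + (h * 2 + (h + h * 4))))) ≡ 18 * h
      arith = solve-∀
      length-bad : length bad ≤ 18 * h
      length-bad = ≤-trans
        (length-++-≤ roots roots≤
          (length-++-≤ bad₂ (length-map-≤ _ (roots ++ N j) (length-++-≤ roots roots≤ (length-N j)))
          (length-++-≤ bad₃ (length-map-≤ _ (allFin t) (≤-reflexive length-allFin))
          (length-++-≤ bad₄ (length-map-≤ _ (allFin t) (≤-reflexive length-allFin))
          (length-map-≤ released (roots ++ taken i ++ H) (length-++-≤ roots roots≤
            (length-++-≤ (taken i) (length-map-≤ _ (wins i M) (few-wins i)) (proj₁ (proj₂ crowded)))))))))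
        (≤-reflexive (arith h))
      choice = avoid bad (ℕₚ.≤-<-trans length-bad (ℕₚ.<-trans (ℕₚ.n<1+n _) n-large))
      x = proj₁ choice
      x∉ : x ∉ bad
      x∉ = proj₂ choice
      y = nb (v i) (κ j ⟨$⟩ʳ x)
      z = nb x a
      z∉ : z ∉ roots ++ N j
      z∉ z∈ = x∉ (∈-++⁺ʳ roots (∈-++⁺ˡ (subst (_∈ bad₂) (nb-nb x a) (∈-map⁺ (λ w → nb w a) z∈))))
      y∉ : y ∉ roots ++ taken i ++ H
      y∉ y∈ = x∉ (∈-++⁺ʳ roots (∈-++⁺ʳ bad₂ (∈-++⁺ʳ bad₃ (∈-++⁺ʳ bad₄ (subst (_∈ bad₅)
        (trans (cong (κ j ⟨$⟩ˡ_) (col-nb (v i) _)) (inverseˡ (κ j))) (∈-map⁺ released y∈))))))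

    record RepairChoice (i : Fin t) (y a : Fin n) : Set where
      field
        y′ : Fin n
        y′-nonroot : Nonroot y′
      b = κ i ⟨$⟩ʳ y
      d = κ i ⟨$⟩ʳ y′
      p = nb y d
      q = nb y′ b
      field
        p-nonroot   : Nonroot p
        q-nonroot   : Nonroot q
        p-unmoved   : p ∉ N i
        q-unmoved   : q ∉ N i
        d≢a         : d ≢ a
        no-conflict : (y , y′) ∉ Conflicts.conflicts i

    -- `p` determines `d` and so `y′`, and `q` determines `y′` through `b`. The excluded `y′` number
    -- 2h as roots, 5h each for `p` and `q`, one for `d≢a` and 6h for the conflicts of `y`.
    choose-repair : ∀ i y a → length (fibre y (Conflicts.conflicts i)) ≤ 6 * h → RepairChoice i y a
    choose-repair i y a uncrowded = record
      { y′          = y′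
      ; y′-nonroot  = ∉-roots (y′∉ ∘ ∈-++⁺ˡ)
      ; p-nonroot   = ∉-roots (p∉ ∘ ∈-++⁺ˡ)
      ; q-nonroot   = ∉-roots (q∉ ∘ ∈-++⁺ˡ)
      ; p-unmoved   = p∉ ∘ ∈-++⁺ʳ roots
      ; q-unmoved   = q∉ ∘ ∈-++⁺ʳ roots
      ; d≢a         = λ eq → y′∉ (∈-++⁺ʳ roots (∈-++⁺ʳ bad₂ (∈-++⁺ʳ bad₃ (here
          (trans (sym (inverseˡ (κ i))) (cong (κ i ⟨$⟩ˡ_) eq))))))
      ; no-conflict = λ ∈conflicts → y′∉ (∈-++⁺ʳ roots (∈-++⁺ʳ bad₂ (∈-++⁺ʳ bad₃ (there
          (∈-map⁺ proj₂ (∈-filter⁺ (λ r → proj₁ r ≟ y) ∈conflicts refl))))))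
      }
      where
      open Conflicts i
      b = κ i ⟨$⟩ʳ y
      bad₂ = map (λ w → κ i ⟨$⟩ˡ col y w) (roots ++ N i)
      bad₃ = map (λ w → nb w b) (roots ++ N i)
      bad₄ = (κ i ⟨$⟩ˡ a) ∷ map proj₂ (fibre y conflicts)
      bad = roots ++ bad₂ ++ bad₃ ++ bad₄
      roots≤ : length roots ≤ t
      roots≤ = ≤-reflexive length-roots
      arith : ∀ h → h * 2 + ((h * 2 + (h + 2 * h)) + ((h * 2 + (h + 2 * h)) + suc (6 * h))) ≡ 1 + 18 * h
      arith = solve-∀
      length-bad : length bad ≤ 1 + 18 * h
      length-bad = ≤-trans
        (length-++-≤ roots roots≤
          (length-++-≤ bad₂ (length-map-≤ _ (roots ++ N i) (length-++-≤ roots roots≤ (length-N i)))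
          (length-++-≤ bad₃ (length-map-≤ _ (roots ++ N i) (length-++-≤ roots roots≤ (length-N i)))
          (s≤s (length-map-≤ proj₂ (fibre y conflicts) uncrowded)))))
        (≤-reflexive (arith h))
      choice = avoid bad (ℕₚ.≤-<-trans length-bad n-large)
      y′ = proj₁ choice
      y′∉ : y′ ∉ bad
      y′∉ = proj₂ choice
      p∉ : nb y (κ i ⟨$⟩ʳ y′) ∉ roots ++ N i
      p∉ p∈ = y′∉ (∈-++⁺ʳ roots (∈-++⁺ˡ (subst (_∈ bad₂)
        (trans (cong (κ i ⟨$⟩ˡ_) (col-nb y _)) (inverseˡ (κ i))) (∈-map⁺ _ p∈))))
      q∉ : nb y′ b ∉ roots ++ N i
      q∉ q∈ = y′∉ (∈-++⁺ʳ roots (∈-++⁺ʳ bad₂ (∈-++⁺ˡ (subst (_∈ bad₃) (nb-nb y′ b) (∈-map⁺ _ q∈)))))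

    -- What the exchange in the losing tree asks of tree `i`: `y-recoloured` frees the edge between
    -- `v i` and `y`, and `avoids` keeps the edge between `x` and `z`, of colour `a`, free.
    record Repaired (i : Fin t) (y b a : Fin n) : Set where
      field
        π            : Permutation′ n
        π-tree       : Tree M (2 + weight i M) i π
        π-disjoint   : ∀ l → l ≢ i → Disjoint (v i) π (v l) (κ l)
        y-recoloured : π ⟨$⟩ʳ y ≢ b
        avoids       : ∀ u → κ i ⟨$⟩ʳ u ≢ a → π ⟨$⟩ʳ u ≢ a
        on-roots     : ∀ m → π ⟨$⟩ʳ v m ≡ κ i ⟨$⟩ʳ v m

    -- Tree `i` contains the edge between `y` and `v i` exactly when it gives `y` the colour `b`;
    -- only then is an exchange made.
    repair : ∀ i y b a → y ≡ nb (v i) b → b ≢ a → Nonroot y →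
      length (fibre y (Conflicts.conflicts i)) ≤ 6 * h → Repaired i y b a
    repair i y b a y≡ b≢a y-nonroot uncrowded with κ i ⟨$⟩ʳ y ≟ b
    ... | no ≢b = record
      { π            = κ i
      ; π-tree       = tree-≤ (ℕₚ.m≤n+m _ 2) (tree S i)
      ; π-disjoint   = λ l l≢i → disjoint S (l≢i ∘ sym)
      ; y-recoloured = ≢b
      ; avoids       = λ _ ≢a → ≢a
      ; on-roots     = λ _ → refl
      }
    ... | yes refl = record
      { π            = swap y y′ (κ i)
      ; π-tree       = replace-child (tree S i) y y′ y-nonroot y′-nonroot child
          p-nonroot p-unmoved q-nonroot q-unmoved
      ; π-disjoint   = λ l l≢i → swap-disjoint y y′ (disjoint S (l≢i ∘ sym))
          (λ eq → no-conflict (y-edge l (sym eq)))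
          (λ eq → no-conflict (y′-edge l (sym eq)))
          (λ eq → no-conflict (p-edge l eq))
          (λ eq → no-conflict (q-edge l eq))
      ; y-recoloured = λ eq → d≢b (trans (sym (swap-first y y′ (κ i))) eq)
      ; avoids       = swap-elim y y′ (κ i) (λ u c → κ i ⟨$⟩ʳ u ≢ a → c ≢ a)
          (λ _ → d≢a) (λ _ → b≢a) (λ _ _ _ ≢a → ≢a)
      ; on-roots     = λ m → swap-other y y′ (κ i) (y-nonroot m ∘ sym) (y′-nonroot m ∘ sym)
      }
      where
      open RepairChoice (choose-repair i y a uncrowded) hiding (b)
      open Conflicts i
      child : par (κ i) y ≡ v i
      child = nb-flip (sym y≡)
      d≢b : d ≢ b
      d≢b eq = p-nonroot i (trans (cong (nb y) eq) child)
      ends : ∀ {u} → κ i ⟨$⟩ˡ (κ i ⟨$⟩ʳ u) ≡ u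
      ends = inverseˡ (κ i)
      -- A new edge that tree `l` already has joins two vertices that are not roots, so `conflicts`
      -- lists it. For `p-edge` and `q-edge`, tree `l` runs along it from the far end.
      y-edge : ∀ l → κ l ⟨$⟩ʳ y ≡ d → (y , y′) ∈ conflicts
      y-edge l eq = ∈-conflicts {l} y-nonroot (subst Nonroot (cong (nb y) (sym eq)) p-nonroot)
        (here (cong (y ,_) (trans (sym ends) (cong (κ i ⟨$⟩ˡ_) (sym eq)))))
      p-edge : ∀ l → κ l ⟨$⟩ʳ p ≡ d → (y , y′) ∈ conflicts
      p-edge l eq = ∈-conflicts {l} p-nonroot (subst Nonroot (sym par≡y) y-nonroot)
        (there (here (cong₂ _,_ (sym par≡y) (trans (sym ends) (cong (κ i ⟨$⟩ˡ_) (sym eq))))))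
        where
        par≡y : par (κ l) p ≡ y
        par≡y = trans (cong (nb p) eq) (nb-nb y d)
      y′-edge : ∀ l → κ l ⟨$⟩ʳ y′ ≡ b → (y , y′) ∈ conflicts
      y′-edge l eq = ∈-conflicts {l} y′-nonroot (subst Nonroot (cong (nb y′) (sym eq)) q-nonroot)
        (there (there (here (cong (_, y′) (trans y≡ (cong (nb (v i)) (sym eq)))))))
      q-edge : ∀ l → κ l ⟨$⟩ʳ q ≡ b → (y , y′) ∈ conflicts
      q-edge l eq = ∈-conflicts {l} q-nonroot (subst Nonroot (sym par≡y′) y′-nonroot)
        (there (there (there (here (cong₂ _,_ (trans y≡ (cong (nb (v i)) (sym eq))) (sym par≡y′))))))
        where
        par≡y′ : par (κ l) q ≡ y′
        par≡y′ = trans (cong (nb q) eq) (nb-nb y′ b)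

    exchange : ∀ {i j} → i ≢ j → (i , j) ∉ M → (R : ReleaseChoice i j) → let open ReleaseChoice R in
      Repaired i y b a → ∃[ κ′ ] State ((i , j) ∷ M) κ′
    exchange {i} {j} i≢j ij∉ R repaired = κ′ , record { tree = tree′ ; disjoint = λ {k} {l} → disjoint′ k l }
      where
      open ReleaseChoice R
      open Repaired repaired
      released = swap (v i) x (κ j)

      κ′ : Fin t → Permutation′ n
      κ′ k with k ≟ j | k ≟ i
      ... | yes _ | _     = released
      ... | no _  | yes _ = π
      ... | no _  | no _  = κ k

      κ′-elim : (P : Fin t → Permutation′ n → Set) → P j released → P i π →
        (∀ k → k ≢ j → k ≢ i → P k (κ k)) → ∀ k → P k (κ′ k)
      κ′-elim P Pj Pi other k with k ≟ j | k ≟ i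
      ... | yes refl | _        = Pj
      ... | no _     | yes refl = Pi
      ... | no k≢j   | no k≢i   = other k k≢j k≢i

      tree′ : ∀ k → Tree ((i , j) ∷ M) (weight k ((i , j) ∷ M)) k (κ′ k)
      tree′ = κ′-elim (λ k ρ → Tree ((i , j) ∷ M) (weight k ((i , j) ∷ M)) k ρ)
        (tree-≤ (weight-loss i j M) (give-up-root (tree S j) x i≢j ij∉ x-nonroot y-nonroot z-nonroot z-unmoved))
        (extend-matches (tree-≤ (weight-win i j M) π-tree) i≢j)
        (λ k k≢j _ → extend-matches (tree-≤ (weight-∷ k (i , j) M) (tree S k)) k≢j)

      -- If tree `l` has given up its edge to `v i`, the present parent of `v i` there is in
      -- `taken i`; otherwise that parent is the root `v l`. Neither can be `y`.
      not-y : ∀ l → b ≢ κ l ⟨$⟩ʳ v i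
      not-y l eq with _∈?_ (≡-dec _≟_ _≟_) (i , l) M
      ... | yes il∈ = y-free (subst (_∈ taken i) (cong (nb (v i)) (sym eq))
        (∈-map⁺ (λ p → par (κ (proj₂ p)) (v i)) (∈-filter⁺ (λ p → proj₁ p ≟ i) il∈ refl)))
      ... | no il∉  = y-nonroot l (trans (cong (nb (v i)) eq) (kept (tree S l) i il∉))

      released-disjoint : ∀ l → l ≢ j → l ≢ i → Disjoint (v j) released (v l) (κ l)
      released-disjoint l l≢j l≢i = swap-disjoint (v i) x (disjoint S (l≢j ∘ sym))
        (not-y l) (x-free l ∘ sym)
        -- The new edge could also run from `y` to a parent `v i`, but only in tree `i` does `v i`
        -- have children.
        (λ eq → l≢i (only-root (tree S l) i y (trans (cong (nb y) eq) (nb-nb (v i) b))))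
        (z-free l)

      released-disjoint-π : Disjoint (v j) released (v i) π
      released-disjoint-π = swap-disjoint (v i) x (Disjoint-sym (π-disjoint j (i≢j ∘ sym)))
        -- Tree `i` could have held the edge from `y` to `v i`; the repair has removed it.
        (λ eq → not-y i (trans eq (on-roots i))) (avoids x (x-free i) ∘ sym) y-recoloured (avoids z (z-free i))

      disjoint′ : ∀ k l → k ≢ l → Disjoint (v k) (κ′ k) (v l) (κ′ l)
      disjoint′ = κ′-elim (λ k ρ → ∀ l → k ≢ l → Disjoint (v k) ρ (v l) (κ′ l))
        (κ′-elim (λ l σ → j ≢ l → Disjoint (v j) released (v l) σ)
          (λ j≢j → contradiction refl j≢j)
          (λ _ → released-disjoint-π)
          (λ l l≢j l≢i _ → released-disjoint l l≢j l≢i))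
        (κ′-elim (λ l σ → i ≢ l → Disjoint (v i) π (v l) σ)
          (λ _ → Disjoint-sym released-disjoint-π)
          (λ i≢i → contradiction refl i≢i)
          (λ l _ l≢i _ → π-disjoint l l≢i))
        (λ k k≢j k≢i → κ′-elim (λ l σ → k ≢ l → Disjoint (v k) (κ k) (v l) σ)
          (λ _ → Disjoint-sym (released-disjoint k k≢j k≢i))
          (λ _ → Disjoint-sym (π-disjoint k k≢i))
          (λ l _ _ k≢l → disjoint S k≢l))

    advance : ∀ i j → i ≢ j → (i , j) ∉ M → ∃[ κ′ ] State ((i , j) ∷ M) κ′
    advance i j i≢j ij∉ = exchange i≢j ij∉ R (repair i y b a refl b≢a y-nonroot y-uncrowded)
      where
      R = choose-release i j
      open ReleaseChoice R
      b≢a : b ≢ a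
      b≢a eq = x-nonroot i (permutation-injective (κ j) eq)

  -- Playing the whole tournament

  open Tournament h

  -- Balance holds for every tail of the schedule, so before each round every tree has moved at most
  -- 3h vertices.
  play : ∀ L → Unique L → All (uncurry Beats) L → ∃[ κ ] State L κ
  play []            _                _                 =
    (λ k → row (v k)) , record { tree = star ; disjoint = star-disjoint }
  play ((i , j) ∷ L) (ij∉ ∷ unique) (i-beats-j ∷ beats) =
    advance (proj₂ (play L unique beats)) (wins-≤ unique beats) (losses-≤ unique beats) i j
      (λ { refl → beats-irrefl i i-beats-j }) (λ ij∈ → All.lookup ij∉ ij∈ refl)

  final : ∃[ κ ] State matches κ
  final = play matches matches-unique matches-beats

  Joined : Permutation′ n → Fin n → Fin n → Set
  Joined π u w = par π u ≡ w ⊎ par π w ≡ u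

  -- A common edge would run in opposite directions and so join `v k` and `v l`; but the loser of
  -- that match has given it up.
  final-edge-disjoint : ∀ {κ} → State matches κ → ∀ {k l u w} → k ≢ l →
    Joined (κ k) u w → Joined (κ l) u w → ⊥
  final-edge-disjoint {κ} S {k} {l} k≢l = λ where
      (inj₁ refl) (inj₁ eq)   → arcs-differ (disjoint S k≢l) _ (nb-injective _ (sym eq))
      (inj₁ refl) (inj₂ eq)   → opposite k≢l eq
      (inj₂ eq)   (inj₁ refl) → opposite (k≢l ∘ sym) eq
      (inj₂ refl) (inj₂ eq)   → arcs-differ (disjoint S k≢l) _ (nb-injective _ (sym eq))
    where
    opposite : ∀ {k l u} → k ≢ l → par (κ l) (par (κ k) u) ≡ u → ⊥
    opposite {k} {l} {u} k≢l eq with antiparallel (disjoint S (k≢l ∘ sym)) u eq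
    ... | refl , eq′ with beats-total k l k≢l
    ...   | inj₁ k-beats-l = lost (tree S l) k (∈-matches k-beats-l) (trans (cong (par (κ l)) (sym eq′)) eq)
    ...   | inj₂ l-beats-k = lost (tree S k) l (∈-matches l-beats-k) eq′

-- Parent functions as trees

lo≢hi : ∀ {n} (e : Edge n) → lo e ≢ hi e
lo≢hi (edge u _ u<u) refl = ⊥-elim-irr (Finₚ.<-irrefl refl u<u)

module ParentGraph {n} (p : Fin n → Fin n) (root : Fin n) (root-fixed : p root ≡ root)
                   (reach : ∀ u → Reach p root u) where

  edge? : ∀ (e : Edge n) → Dec (p (lo e) ≡ hi e ⊎ p (hi e) ≡ lo e)
  edge? e = (p (lo e) ≟ hi e) ⊎-dec (p (hi e) ≟ lo e)

  graph : Subgraph n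
  graph = record { vertices = full ; edges = λ e → ⌊ edge? e ⌋ ; endpoints = λ _ _ _ _ → ∈⊤ }

  Adj : Fin n → Fin n → Set
  Adj = Adjacent graph

  adjacent⇒ : ∀ {u w} → Adj u w → p u ≡ w ⊎ p w ≡ u
  adjacent⇒ (e , e∈ , inj₁ (refl , refl)) = toWitness e∈
  adjacent⇒ (e , e∈ , inj₂ (refl , refl)) = Sum.swap (toWitness e∈)

  adjacent-distinct : ∀ {u w} → Adj u w → u ≢ w
  adjacent-distinct (e , _ , inj₁ (refl , refl)) eq = lo≢hi e eq
  adjacent-distinct (e , _ , inj₂ (refl , refl)) eq = lo≢hi e (sym eq)

  adjacent-sym : ∀ {u w} → Adj u w → Adj w u
  adjacent-sym (e , e∈ , inj₁ (u≡lo , w≡hi)) = e , e∈ , inj₂ (w≡hi , u≡lo)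
  adjacent-sym (e , e∈ , inj₂ (u≡hi , w≡lo)) = e , e∈ , inj₁ (w≡lo , u≡hi)

  parent-adjacent : ∀ {u} → u ≢ p u → Adj u (p u)
  parent-adjacent {u} u≢pu with <-cmp u (p u)
  ... | tri< u<pu _ _ = edge u (p u) u<pu , fromWitness (inj₁ refl) , inj₁ (refl , refl)
  ... | tri≈ _ u≡pu _ = contradiction u≡pu u≢pu
  ... | tri> _ _ pu<u = edge (p u) u pu<u , fromWitness (inj₂ refl) , inj₂ (refl , refl)

  depth : ∀ {u} → Reach p root u → ℕ
  depth here       = 0
  depth (step _ r) = suc (depth r)

  -- `step` excludes the root, so a derivation cannot loop at the root, which is its own parent.
  depth-unique : ∀ {u} (r s : Reach p root u) → depth r ≡ depth s
  depth-unique here         here         = refl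
  depth-unique here         (step ≢root _)   = contradiction refl ≢root
  depth-unique (step ≢root _)   here         = contradiction refl ≢root
  depth-unique (step _ r)   (step _ s)   = cong suc (depth-unique r s)

  δ : Fin n → ℕ
  δ u = depth (reach u)

  δ-parent : ∀ {u} → u ≢ root → δ (p u) < δ u
  δ-parent {u} u≢root = ℕₚ.≤-reflexive
    (depth-unique (step u≢root (reach (p u))) (reach u))

  δ-adjacent : ∀ {u w} → Adj u w → p u ≡ w → δ w < δ u
  δ-adjacent {u} u~w refl = δ-parent λ { refl → adjacent-distinct u~w (sym root-fixed) }

  to-root : ∀ {u} → Reach p root u → Star Adj u root
  to-root here              = ε
  to-root {u} (step u≢root r) =
    parent-adjacent (λ eq → ℕₚ.<-irrefl (cong δ (sym eq)) (δ-parent u≢root)) ◅ to-root r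

  -- A walk that never turns back and has once gone away from the root keeps going away from it.
  descending : ∀ {u w} ws s → p w ≡ u → u ≢ s → Linked Adj (w ∷ (ws ∷ʳ s)) → Unique (u ∷ w ∷ ws) →
    (∀ {x} → x ∈ w ∷ ws → x ≢ s) → δ w < δ s × p s ∈ w ∷ ws
  descending {u} {w} [] s pw≡u u≢s (w~s ∷ _) _ _ with adjacent⇒ w~s
  ... | inj₁ pw≡s = contradiction (trans (sym pw≡u) pw≡s) u≢s
  ... | inj₂ ps≡w = δ-adjacent (adjacent-sym w~s) ps≡w , here ps≡w
  descending {u} {w} (x ∷ ws) s pw≡u u≢s (w~x ∷ walk) ((_ ∷ u≢x ∷ _) ∷ unique) misses with adjacent⇒ w~x
  ... | inj₁ pw≡x = contradiction (trans (sym pw≡u) pw≡x) u≢x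
  ... | inj₂ px≡w =
    let δx<δs , ps∈ = descending ws s px≡w (misses (here refl)) walk unique (misses ∘ there)
    in ℕₚ.<-trans (δ-adjacent (adjacent-sym w~x) px≡w) δx<δs , there ps∈

  -- Either the walk rises all the way to `s`, or it turns downwards at some step and `descending`
  -- takes over.
  ascending-or-child : ∀ {w} ws s → Linked Adj (w ∷ (ws ∷ʳ s)) → Unique (w ∷ ws) →
    (∀ {x} → x ∈ w ∷ ws → x ≢ s) → δ s < δ w ⊎ p s ∈ w ∷ ws
  ascending-or-child [] s (w~s ∷ _) _ _ with adjacent⇒ w~s
  ... | inj₁ pw≡s = inj₁ (δ-adjacent w~s pw≡s)
  ... | inj₂ ps≡w = inj₂ (here ps≡w)
  ascending-or-child (x ∷ ws) s (w~x ∷ walk) unique@(_ ∷ unique′) misses with adjacent⇒ w~x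
  ... | inj₂ px≡w = inj₂ (there (proj₂ (descending ws s px≡w (misses (here refl)) walk unique (misses ∘ there))))
  ... | inj₁ pw≡x with ascending-or-child ws s walk unique′ (misses ∘ there)
  ...   | inj₁ δs<δx = inj₁ (ℕₚ.<-trans δs<δx (δ-adjacent w~x pw≡x))
  ...   | inj₂ ps∈   = inj₂ (there ps∈)

  -- A cycle that first goes down gets ever deeper and cannot return. One that first goes up to the
  -- parent `w` either keeps rising and cannot return, or comes down and visits the parent of
  -- `start`, which is `w`, a second time.
  no-cycle : ¬ Cycle graph
  no-cycle record { start = s ; rest = [] ; long = () }
  no-cycle record { start = s ; rest = _ ∷ [] ; long = s≤s () }
  no-cycle record { start = s ; rest = w ∷ x ∷ ws ; distinct = s∉ ∷ unique@(w∉ ∷ unique′) ; closed = s~w ∷ walk } =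
    go (adjacent⇒ s~w)
    where
    misses : ∀ {y} → y ∈ w ∷ x ∷ ws → y ≢ s
    misses y∈ eq = All.lookup s∉ y∈ (sym eq)
    from-x : ∀ {w x} → Linked Adj (w ∷ (x ∷ ws) ∷ʳ s) → Adj w x × Linked Adj (x ∷ (ws ∷ʳ s))
    from-x (w~x ∷ walk) = w~x , walk
    child : p s ≡ w → p s ∉ x ∷ ws
    child ps≡w ps∈ = All.lookup w∉ ps∈ (sym ps≡w)
    go : p s ≡ w ⊎ p w ≡ s → ⊥
    go (inj₂ pw≡s) with from-x walk
    ... | w~x , walk′ with adjacent⇒ w~x
    ...   | inj₁ pw≡x = misses (there (here refl)) (trans (sym pw≡x) pw≡s)
    ...   | inj₂ px≡w = ℕₚ.<-asym (ℕₚ.<-trans (δ-adjacent (adjacent-sym s~w) pw≡s)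
              (δ-adjacent (adjacent-sym w~x) px≡w))
              (proj₁ (descending ws s px≡w (misses (here refl)) walk′ unique (misses ∘ there)))
    go (inj₁ ps≡w) with from-x walk
    ... | w~x , walk′ with adjacent⇒ w~x
    ...   | inj₂ px≡w = child ps≡w (proj₂ (descending ws s px≡w (misses (here refl)) walk′ unique (misses ∘ there)))
    ...   | inj₁ pw≡x with ascending-or-child ws s walk′ unique′ (misses ∘ there)
    ...     | inj₁ δs<δx = ℕₚ.<-asym δs<δx (ℕₚ.<-trans (δ-adjacent w~x pw≡x) (δ-adjacent s~w ps≡w))
    ...     | inj₂ ps∈   = child ps≡w ps∈

  graph-isTree : IsTree graph
  graph-isTree = record
    { connected = record
      { nonempty = root , ∈⊤
      ; walk     = λ u w _ _ → to-root (reach u) ◅◅ reverse adjacent-sym (to-root (reach w))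
      }
    ; acyclic   = no-cycle
    }

-- From the colouring to the Latin square, and from trees to rainbow subgraphs

-- If `f` missed `b`, punching out `b` would inject `Fin (suc n)` into `Fin n`.
injective⇒permutation : ∀ {n} (f : Fin n → Fin n) → (∀ {u w} → f u ≡ f w → u ≡ w) →
  Σ[ π ∈ Permutation′ n ] (∀ u → π ⟨$⟩ʳ u ≡ f u)
injective⇒permutation {zero}  f _   = permutation f f (λ ()) (λ ()) , λ _ → refl
injective⇒permutation {suc n} f inj =
  permutation f (proj₁ ∘ preimage) (proj₂ ∘ preimage) (λ u → inj (proj₂ (preimage (f u)))) , λ _ → refl
  where
  preimage : ∀ b → ∃[ u ] f u ≡ b
  preimage b with any? (λ u → f u ≟ b)
  ... | yes found = found
  ... | no missed = contradiction
    (injective⇒≤ {f = λ u → punchOut {i = b} {f u} (λ eq → missed (u , sym eq))}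
      (λ {u} {w} → inj ∘ punchOut-injective (λ eq → missed (u , sym eq)) (λ eq → missed (w , sym eq))))
    (ℕₚ.<⇒≱ (ℕₚ.n<1+n n))

edge-between : ∀ {n} {u w : Fin n} → u ≢ w → ∃[ e ] Joins e u w
edge-between {u = u} {w} u≢w with <-cmp u w
... | tri< u<w _ _ = edge u w u<w , inj₁ (refl , refl)
... | tri≈ _ u≡w _ = contradiction u≡w u≢w
... | tri> _ _ w<u = edge w u w<u , inj₂ (refl , refl)

joins-sym : ∀ {n} (e : Edge n) {u w} → Joins e u w → Joins e w u
joins-sym _ (inj₁ (u≡lo , w≡hi)) = inj₂ (w≡hi , u≡lo)
joins-sym _ (inj₂ (u≡hi , w≡lo)) = inj₁ (w≡lo , u≡hi)

joins-end : ∀ {n} (e : Edge n) {u w} → Joins e u w → u ∈ᵉ e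
joins-end _ (inj₁ (u≡lo , _)) = inj₁ u≡lo
joins-end _ (inj₂ (u≡hi , _)) = inj₂ u≡hi

joins-unique : ∀ {n} (e : Edge n) {u w x} → Joins e u w → Joins e u x → w ≡ x
joins-unique _ (inj₁ (_ , refl)) (inj₁ (_ , refl))  = refl
joins-unique e (inj₁ (refl , _)) (inj₂ (lo≡hi , _)) = contradiction lo≡hi (lo≢hi e)
joins-unique e (inj₂ (refl , _)) (inj₁ (hi≡lo , _)) = contradiction (sym hi≡lo) (lo≢hi e)
joins-unique _ (inj₂ (_ , refl)) (inj₂ (_ , refl))  = refl

joins⇒≡ : ∀ {n} (e f : Edge n) {u w} → Joins e u w → Joins f u w → e ≡ f
joins⇒≡ _            _            (inj₁ (refl , refl)) (inj₁ (refl , refl)) = refl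
joins⇒≡ (edge _ _ p) (edge _ _ q) (inj₁ (refl , refl)) (inj₂ (refl , refl)) = ⊥-elim-irr (Finₚ.<-asym p q)
joins⇒≡ (edge _ _ p) (edge _ _ q) (inj₂ (refl , refl)) (inj₁ (refl , refl)) = ⊥-elim-irr (Finₚ.<-asym p q)
joins⇒≡ _            _            (inj₂ (refl , refl)) (inj₂ (refl , refl)) = refl

module FromColouring {m} (c : EdgeColouring (suc m) (Fin m)) (proper : Proper c) where

  -- The extra colour `zero` on the diagonal makes colours as many as vertices, so that injective
  -- rows are permutations.
  colour : Fin (suc m) → Fin (suc m) → Fin (suc m)
  colour u w with <-cmp u w
  ... | tri< u<w _ _ = suc (c (edge u w u<w))
  ... | tri≈ _ _ _   = zero
  ... | tri> _ _ w<u = suc (c (edge w u w<u))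

  colour-diag : ∀ u → colour u u ≡ zero
  colour-diag u with <-cmp u u
  ... | tri< _ u≢u _ = contradiction refl u≢u
  ... | tri≈ _ _ _   = refl
  ... | tri> _ u≢u _ = contradiction refl u≢u

  colour-joins : ∀ e {u w} → Joins e u w → colour u w ≡ suc (c e)
  colour-joins e@(edge _ _ lo<hi) {u} {w} (inj₁ (refl , refl)) with <-cmp u w
  ... | tri< _ _ _     = refl
  ... | tri≈ _ lo≡hi _ = contradiction lo≡hi (lo≢hi e)
  ... | tri> _ _ hi<lo = ⊥-elim-irr (Finₚ.<-asym hi<lo lo<hi)
  colour-joins e@(edge _ _ lo<hi) {u} {w} (inj₂ (refl , refl)) with <-cmp u w
  ... | tri< hi<lo _ _ = ⊥-elim-irr (Finₚ.<-asym hi<lo lo<hi)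
  ... | tri≈ _ hi≡lo _ = contradiction (sym hi≡lo) (lo≢hi e)
  ... | tri> _ _ _     = refl

  colour-sym : ∀ u w → colour u w ≡ colour w u
  colour-sym u w with u ≟ w
  ... | yes refl = refl
  ... | no u≢w   = let e , joins = edge-between u≢w in
    trans (colour-joins e joins) (sym (colour-joins e (joins-sym e joins)))

  colour-off-diag : ∀ {u w} → u ≢ w → colour u w ≢ zero
  colour-off-diag u≢w eq = let e , joins = edge-between u≢w in
    Finₚ.0≢1+n (trans (sym eq) (colour-joins e joins))

  colour-injective : ∀ u {w x} → colour u w ≡ colour u x → w ≡ x
  colour-injective u {w} {x} eq with u ≟ w | u ≟ x
  ... | yes u≡w  | yes u≡x  = trans (sym u≡w) u≡x
  ... | yes refl | no u≢x   = contradiction (trans (sym eq) (colour-diag u)) (colour-off-diag u≢x)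
  ... | no u≢w   | yes refl = contradiction (trans eq (colour-diag u)) (colour-off-diag u≢w)
  ... | no u≢w   | no u≢x with w ≟ x
  ...   | yes w≡x = w≡x
  ...   | no w≢x with edge-between u≢w | edge-between u≢x
  ...     | e , e-joins | f , f-joins = contradiction
    (Finₚ.suc-injective (trans (sym (colour-joins e e-joins)) (trans eq (colour-joins f f-joins))))
    (proper e f (λ { refl → w≢x (joins-unique e e-joins f-joins) })
      (u , joins-end e e-joins , joins-end f f-joins))

  square : SymmetricLatinSquare (suc m)
  square = record
    { row      = λ u → proj₁ (row u)
    ; row-sym  = λ u w → trans (proj₂ (row u) w) (trans (colour-sym u w) (sym (proj₂ (row w) u)))
    ; 0#       = zero
    ; row-diag = λ u → trans (proj₂ (row u) u) (colour-diag u)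
    }
    where row = λ u → injective⇒permutation (colour u) (colour-injective u)

  col≡colour : ∀ u w → SymmetricLatinSquare.row square u ⟨$⟩ʳ w ≡ colour u w
  col≡colour u w = proj₂ (injective⇒permutation (colour u) (colour-injective u)) w

  module _ {h : ℕ} (h-small : 1 + 18 * h < suc m) where

    private
      t≤n : h * 2 ≤ suc m
      t≤n = ℕₚ.≤-trans (ℕₚ.≤-reflexive (ℕₚ.*-comm h 2))
        (ℕₚ.≤-trans (ℕₚ.*-monoˡ-≤ h (ℕₚ.m≤m+n 2 16)) (ℕₚ.<⇒≤ (ℕₚ.<-trans (ℕₚ.n<1+n _) h-small)))

      v : Fin (h * 2) → Fin (suc m)
      v k = inject≤ k t≤n

      v-injective : ∀ k l → v k ≡ v l → k ≡ l
      v-injective = inject≤-injective t≤n t≤n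

    open Trees square v (λ {k} {l} → v-injective k l)
    open Exchange square v (λ {k} {l} → v-injective k l)
    open Round square {h} v (λ {k} {l} → v-injective k l) h-small

    private
      κ = proj₁ final
      S = proj₂ final
      module G k = ParentGraph (par (κ k)) (v k) (par-root (tree S k)) (reach (tree S k))

    spanning-tree : Fin (h * 2) → Subgraph (suc m)
    spanning-tree = G.graph

    edge-child : ∀ k e → e ∈ᴱ spanning-tree k →
      ∃[ u ] κ k ⟨$⟩ʳ u ≡ suc (c e) × Joins e u (par (κ k) u)
    edge-child k e e∈ = case-edge (toWitness e∈)
      where
      from-joins : ∀ {u} → Joins e u (par (κ k) u) →
        ∃[ u ] κ k ⟨$⟩ʳ u ≡ suc (c e) × Joins e u (par (κ k) u)
      from-joins {u} joins = u , trans (par-col (κ k) u) (trans (col≡colour u _) (colour-joins e joins)) , joins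
      case-edge : par (κ k) (lo e) ≡ hi e ⊎ par (κ k) (hi e) ≡ lo e →
        ∃[ u ] κ k ⟨$⟩ʳ u ≡ suc (c e) × Joins e u (par (κ k) u)
      case-edge (inj₁ eq) = from-joins (inj₁ (refl , eq))
      case-edge (inj₂ eq) = from-joins (inj₂ (refl , eq))

    -- Edges of equal colour have the same child, as the permutation is injective, and the child
    -- determines its edge to the parent.
    rainbow : ∀ k → Rainbow c (spanning-tree k)
    rainbow k e f e∈ f∈ e≢f same with edge-child k e e∈ | edge-child k f f∈
    ... | u , κu , e-joins | w , κw , f-joins
      with permutation-injective (κ k) (trans κu (trans (cong suc same) (sym κw)))
    ... | refl = e≢f (joins⇒≡ e f e-joins f-joins)

    spanning-trees : Σ[ t ∈ (Fin (h * 2) → Subgraph (suc m)) ]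
      (∀ k → IsSpanningRainbowTree c (t k)) × (∀ k l → k ≢ l → EdgeDisjoint (t k) (t l))
    spanning-trees = spanning-tree
      , (λ k → record { isTree = G.graph-isTree k ; spanning = λ _ → ∈⊤ ; rainbow = rainbow k })
      , λ k l k≢l e (e∈k , e∈l) → final-edge-disjoint S k≢l (toWitness e∈k) (toWitness e∈l)

-- The numerical bound

-- Multiplied by 9, the claim is n - 54 ≤ 9k. Unnormalised rationals keep the denominator 9 of
-- `+ n / 9` visible.
enough : ∀ n k → n ≤ 9 * k + 54 → + k / 1 ≥ + n / 9 - + 6 / 1
enough n k n≤ = ℚₚ.toℚᵘ-cancel-≤ (begin
  toℚᵘ (+ n / 9 - + 6 / 1)                ≃⟨ ℚₚ.toℚᵘ-homo-+ (+ n / 9) (- (+ 6 / 1)) ⟩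
  toℚᵘ (+ n / 9) ℚᵘ.+ mkℚᵘ (ℤ.- + 6) 0    ≃⟨ ℚᵘₚ.+-congˡ (mkℚᵘ (ℤ.- + 6) 0) (ℚₚ.toℚᵘ-fromℚᵘ (mkℚᵘ (+ n) 8)) ⟩
  mkℚᵘ (+ n) 8 ℚᵘ.+ mkℚᵘ (ℤ.- + 6) 0      ≤⟨ *≤* integral ⟩
  mkℚᵘ (+ k) 0                            ≃⟨ ℚₚ.toℚᵘ-fromℚᵘ (mkℚᵘ (+ k) 0) ⟨
  toℚᵘ (+ k / 1)                          ∎)
  where
  open ℚᵘₚ.≤-Reasoning
  integral : (+ n ℤ.* + 1 ℤ.+ (ℤ.- + 6) ℤ.* + 9) ℤ.* + 1 ℤ.≤ + k ℤ.* + 9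
  integral = ℤₚ.≤-trans (ℤₚ.≤-reflexive (lhs (+ n)))
    (ℤₚ.≤-trans (ℤₚ.+-monoˡ-≤ (ℤ.- + 54) (ℤ.+≤+ n≤))
      (ℤₚ.≤-reflexive (trans (cong (λ i → i ℤ.+ + 54 ℤ.- + 54) (ℤₚ.pos-* 9 k)) (rhs (+ k)))))
    where
    lhs : ∀ i → (i ℤ.* + 1 ℤ.+ (ℤ.- + 6) ℤ.* + 9) ℤ.* + 1 ≡ i ℤ.- + 54
    lhs = ℤ-Solver.solve-∀
    rhs : ∀ i → + 9 ℤ.* i ℤ.+ + 54 ℤ.- + 54 ≡ i ℤ.* + 9
    rhs = ℤ-Solver.solve-∀

theorem5 : (n : ℕ) → .{{_ : NonZero n}} →
    (c : EdgeColouring n (Fin (n ∸ 1))) → Proper c →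
    Σ[ k ∈ ℕ ] ((+ k / 1 ≥ + n / 9 - + 6 / 1) ×
    (Σ[ t ∈ (Fin k → Subgraph n) ]
    ((∀ (i : Fin k) → IsSpanningRainbowTree c (t i)) ×
    (∀ (i j : Fin k) → i ≢ j → EdgeDisjoint (t i) (t j)))))
-- For a single vertex the bound is negative, so no tree is required.
theorem5 1             c proper = 0 , enough 1 0 (s≤s z≤n) , (λ ()) , (λ ()) , (λ ())
theorem5 (suc (suc m)) c proper = h * 2 , enough (2 + m) (h * 2) n≤ ,
  FromColouring.spanning-trees c proper {h} h-small
  where
  -- The largest `h` with 18h + 2 ≤ n, where n is `2 + m`.
  h = m /ℕ 18
  h-small : 1 + 18 * h < 2 + m
  h-small = s≤s (s≤s (ℕₚ.≤-trans (ℕₚ.≤-reflexive (ℕₚ.*-comm 18 h)) (m/n*n≤m m 18)))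
  n≤ : 2 + m ≤ 9 * (h * 2) + 54
  n≤ = ℕₚ.≤-trans (ℕₚ.+-monoʳ-≤ 2 (ℕₚ.≤-trans (ℕₚ.≤-reflexive (m≡m%n+[m/n]*n m 18))
      (ℕₚ.+-monoˡ-≤ (h * 18) (ℕₚ.<⇒≤ (m%n<n m 18)))))
    -- Division by 18 gives n ≤ 18h + 20; the slack up to 18h + 54 is 34.
    (ℕₚ.≤-trans (ℕₚ.m≤m+n _ 34) (ℕₚ.≤-reflexive (arith h)))
    where
    arith : ∀ h → 2 + (18 + h * 18) + 34 ≡ 9 * (h * 2) + 54
    arith = solve-∀
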